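{- For $B=\{x,y\}$ the equivalence relation $\equiv_{\textsc{MaxCut},B}$ restricted to $B$-boundaried graphs $G_B$ with $G-B$ edgeless has infinitely many equivalence classes; consequently, the parameterized problem \textsc{Maximum Cut}[vc] does not admit a boundaried kernelization (of any computable size $f$).
   Context: A boundaried graph $G_B$ is a finite simple graph $G$ together with a set $B\subseteq V(G)$ (the boundary). For boundaried graphs $G_B$ and $H_C$ with $V(G)\cap V(H)\subseteq B\cap C$, the gluing $G_B\oplus H_C$ is the simple graph obtained from the disjoint union of $G$ and $H$ by identifying each vertex of $B\cap C$ in $G$ with the identically named vertex in $H$ (an edge present in both is kept once). For an isomorphism-invariant optimization problem $\Pi$ on graphs with optimum value $\mathrm{OPT}_\Pi(G)$, two $B$-boundaried graphs $G_B,G'_B$ are gluing equivalent w.r.t. $\Pi$ and $B$, written $G_B\equiv_{\Pi,B}G'_B$, if there is $\Delta\in\mathbb{Z}$ with $\mathrm{OPT}_\Pi(G_B\oplus H_B)=\mathrm{OPT}_\Pi(G'_B\oplus H_B)+\Delta$ for every boundaried graph $H_B$. For a pure graph minimization problem $\rho$, a $\rho$-solution of $G$ is a feasible solution $s$ with value $\rho(G,s)$. For computable $f$, a boundaried kernelization of size $f$ for $\Pi[\rho]$ is a polynomial-time algorithm that, given a boundaried graph $G_B$ and a $\rho$-solution $s$ of $G$, outputs a boundaried graph $G'_B$ with $G_B\equiv_{\Pi,B}G'_B$, a $\rho$-solution $s'$ of $G'$ with $|G'|,|s'|,\rho(G',s')\le f(|B|+\rho(G,s))$ (encoding sizes), and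 an integer $\Delta$ with $\mathrm{OPT}_\Pi(G_B\oplus H_B)=\mathrm{OPT}_\Pi(G'_B\oplus H_B)+\Delta$ for all $H_B$. \textsc{Maximum Cut} is the maximization problem whose feasible solutions on $G$ are partitions $V(G)=X\,\dot\cup\,Y$, with value the number of edges with one endpoint in $X$ and one in $Y$. \textsc{Vertex Cover} (vc) is the minimization problem with feasible solutions $S\subseteq V(G)$ such that $G-S$ is edgeless, value $|S|$; \textsc{Maximum Cut}[vc] means $\rho=$ \textsc{Vertex Cover}. -}

module Defs where

open import Data.Bool.Base using (Bool; true; false; _∧_; _∨_; not; if_then_else_)
open import Data.Fin.Base using (Fin; splitAt; _↑ˡ_; _↑ʳ_)
open import Data.Fin.Subset using (Subset; inside; outside; _∉_; ∣_∣)
open import Data.Integer.Base as ℤ using (ℤ; -[1+_])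
import Data.Integer.Properties as ℤₚ
open import Data.List.Base as List using (List; []; _∷_; _++_; length; concatMap; allFin)
open import Data.Maybe.Base as Maybe using (Maybe; just; nothing)
open import Data.Nat.Base using (ℕ; zero; suc; _+_; _*_; _^_; _≤_; _⊔_)
open import Data.Nat.Binary.Base as ℕᵇ using (ℕᵇ; 2[1+_]; 1+[2_])
open import Data.Nat.Properties using (+-0-commutativeMonoid; ≤-trans; ≤-refl; m≤m⊔n; m≤n⊔m; ⊔-sel)
open import Data.Product.Base using (Σ; ∃-syntax; _×_; _,_; proj₁; proj₂)
open import Data.Sum.Base using ([_,_]′; inj₁; inj₂)
open import Data.Vec.Base as Vec using (Vec; []; _∷_; lookup; replicate)
open import Function.Base using (const)
open import Function.Bundles using (Injection)
open import Level using (0ℓ)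
open import Relation.Binary.Bundles using (Setoid)
open import Relation.Binary.Construct.On as On using ()
open import Relation.Binary.PropositionalEquality as ≡ using (_≡_; refl; sym; trans; cong; cong₂)

------------------------------------------------------------------------
-- Graphs

record Graph (n : ℕ) : Set where
  field
    adj        : Fin n → Fin n → Bool
    symmetric  : ∀ u v → adj u v ≡ adj v u
    irreflexive : ∀ v → adj v v ≡ false

open Graph public

-- "G − S is edgeless".
EdgelessWithout : ∀ {n} → Graph n → Subset n → Set
EdgelessWithout G S = ∀ u v → u ∉ S → v ∉ S → adj G u v ≡ false

-- Boundaried graphs with a boundary B of size b.  The names of the
-- vertices matter only for telling which boundary vertices are
-- identified by gluing, so B is normalised to Fin b and sits in
-- V(G) = Fin (b + inner) as the first b vertices.  With arbitrary names
-- the size of an encoding could not be bounded in terms of |B|, since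
-- the names in B would have to be written down.
record BoundariedGraph (b : ℕ) : Set where
  field
    inner : ℕ
    graph : Graph (b + inner)

  boundary : Subset (b + inner)
  boundary = replicate b inside Vec.++ replicate inner outside

open BoundariedGraph public

-- The vertex set of a gluing is B followed by the inner vertices of the
-- left graph and those of the right graph.  The two maps below are the
-- partial inverses of the inclusions of the left and right vertex sets.
toLeft : ∀ b n m → Fin (b + (n + m)) → Maybe (Fin (b + n))
toLeft b n m v =
  [ (λ x → just (x ↑ˡ n))
  , (λ w → [ (λ i → just (b ↑ʳ i)) , const nothing ]′ (splitAt n w))
  ]′ (splitAt b v)

toRight : ∀ b n m → Fin (b + (n + m)) → Maybe (Fin (b + m))
toRight b n m v =
  [ (λ x → just (x ↑ˡ m))
  , (λ w → [ const nothing , (λ j → just (b ↑ʳ j)) ]′ (splitAt n w))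
  ]′ (splitAt b v)

adj? : ∀ {n} → Graph n → Maybe (Fin n) → Maybe (Fin n) → Bool
adj? G (just u) (just v) = adj G u v
adj? G (just _) nothing  = false
adj? G nothing  _        = false

adj?-symmetric : ∀ {n} (G : Graph n) u v → adj? G u v ≡ adj? G v u
adj?-symmetric G (just u) (just v) = symmetric G u v
adj?-symmetric G (just _) nothing  = refl
adj?-symmetric G nothing  (just _) = refl
adj?-symmetric G nothing  nothing  = refl

adj?-irreflexive : ∀ {n} (G : Graph n) v → adj? G v v ≡ false
adj?-irreflexive G (just v) = irreflexive G v
adj?-irreflexive G nothing  = refl

infixl 6 _⊕_

_⊕_ : ∀ {b} (G H : BoundariedGraph b) → Graph (b + (inner G + inner H))
_⊕_ {b} G H = record
  { adj         = λ u v → adj? (graph G) (l u) (l v) ∨ adj? (graph H) (r u) (r v)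
  ; symmetric   = λ u v → cong₂ _∨_ (adj?-symmetric (graph G) (l u) (l v))
                                    (adj?-symmetric (graph H) (r u) (r v))
  ; irreflexive = λ v → cong₂ _∨_ (adj?-irreflexive (graph G) (l v))
                                  (adj?-irreflexive (graph H) (r v))
  }
  where
  l : Fin (b + (inner G + inner H)) → Maybe (Fin (b + inner G))
  l = toLeft b (inner G) (inner H)
  r : Fin (b + (inner G + inner H)) → Maybe (Fin (b + inner H))
  r = toRight b (inner G) (inner H)

------------------------------------------------------------------------
-- Gluing equivalence, for a problem given by its optimum value

Optimum : Set
Optimum = ∀ {n} → Graph n → ℤ

GluingEquivalentBy : ∀ {b} → Optimum → BoundariedGraph b → BoundariedGraph b → ℤ → Set
GluingEquivalentBy {b} OPT G G′ Δ =
  ∀ (H : BoundariedGraph b) → OPT (G ⊕ H) ≡ OPT (G′ ⊕ H) ℤ.+ Δ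

GluingEquivalent : ∀ {b} → Optimum → BoundariedGraph b → BoundariedGraph b → Set
GluingEquivalent OPT G G′ = ∃[ Δ ] GluingEquivalentBy OPT G G′ Δ

gluingSetoid : Optimum → ℕ → Setoid 0ℓ 0ℓ
gluingSetoid OPT b = record
  { Carrier       = BoundariedGraph b
  ; _≈_           = GluingEquivalent OPT
  ; isEquivalence = record
    { refl  = ℤ.0ℤ , λ H → sym (ℤₚ.+-identityʳ _)
    ; sym   = λ { {G} {G′} (Δ , e) → ℤ.- Δ , λ H →
        sym (trans (cong (ℤ._+ ℤ.- Δ) (e H))
            (trans (ℤₚ.+-assoc (OPT (G′ ⊕ H)) Δ (ℤ.- Δ))
            (trans (cong (λ z → OPT (G′ ⊕ H) ℤ.+ z) (ℤₚ.+-inverseʳ Δ))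
                   (ℤₚ.+-identityʳ _)))) }
    ; trans = λ { {G} {G′} {G″} (Δ , e) (Δ′ , e′) → Δ′ ℤ.+ Δ , λ H →
        trans (e H) (trans (cong (ℤ._+ Δ) (e′ H)) (ℤₚ.+-assoc (OPT (G″ ⊕ H)) Δ′ Δ)) }
    }
  }

-- The restriction to boundaried graphs G_B with G − B edgeless.
edgelessGluingSetoid : Optimum → ℕ → Setoid 0ℓ 0ℓ
edgelessGluingSetoid OPT b =
  On.setoid {B = Σ (BoundariedGraph b) λ G → EdgelessWithout (graph G) (boundary G)}
            (gluingSetoid OPT b) proj₁

-- A sequence of pairwise inequivalent elements.
InfinitelyManyClasses : Setoid 0ℓ 0ℓ → Set
InfinitelyManyClasses S = Injection (≡.setoid ℕ) S

------------------------------------------------------------------------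
-- Maximum Cut

-- The partition is X and its complement.  Each cut edge is counted once,
-- namely as the pair (u , v) with u in X and v not in X.
cutSize : ∀ {n} → Graph n → Subset n → ℕ
cutSize {n} G X =
  ∑[ u < n ] ∑[ v < n ] (if lookup X u ∧ not (lookup X v) ∧ adj G u v then 1 else 0)
  where open import Algebra.Properties.CommutativeMonoid.Sum +-0-commutativeMonoid

maxOverSubsets : ∀ {n} → (Subset n → ℕ) → ℕ
maxOverSubsets {zero}  f = f []
maxOverSubsets {suc n} f =
  maxOverSubsets (λ X → f (inside ∷ X)) ⊔ maxOverSubsets (λ X → f (outside ∷ X))

maxOverSubsets-upper : ∀ {n} (f : Subset n → ℕ) X → f X ≤ maxOverSubsets f
maxOverSubsets-upper f []            = ≤-refl
maxOverSubsets-upper f (inside ∷ X)  = ≤-trans (maxOverSubsets-upper _ X) (m≤m⊔n _ _)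
maxOverSubsets-upper f (outside ∷ X) = ≤-trans (maxOverSubsets-upper _ X)
  (m≤n⊔m (maxOverSubsets (λ Y → f (inside ∷ Y))) _)

maxOverSubsets-attained : ∀ {n} (f : Subset n → ℕ) → ∃[ X ] f X ≡ maxOverSubsets f
maxOverSubsets-attained {zero}  f = [] , refl
maxOverSubsets-attained {suc n} f
  with ⊔-sel (maxOverSubsets (λ X → f (inside ∷ X))) (maxOverSubsets (λ X → f (outside ∷ X)))
... | inj₁ e = let X , p = maxOverSubsets-attained (λ X → f (inside ∷ X))
               in inside ∷ X , trans p (sym e)
... | inj₂ e = let X , p = maxOverSubsets-attained (λ X → f (outside ∷ X))
               in outside ∷ X , trans p (sym e)

maxCut : Optimum
maxCut G = ℤ.+ maxOverSubsets (cutSize G)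

------------------------------------------------------------------------
-- Turing machines (deterministic, one two-way infinite tape)

Word : Set
Word = List Bool

data Symbol (k : ℕ) : Set where
  blank : Symbol k
  bit   : Bool → Symbol k
  aux   : Fin k → Symbol k

data Move : Set where
  left stay right : Move

record TuringMachine : Set where
  field
    states : ℕ
    extra  : ℕ
    start  : Fin states
    -- The machine halts where δ is nothing.
    δ      : Fin states → Symbol extra → Maybe (Fin states × Symbol extra × Move)

-- 'before' lists the cells to the left of the head, nearest first; all
-- cells not listed are blank.
record Configuration (M : TuringMachine) : Set where
  constructor config
  open TuringMachine M
  field
    state   : Fin states
    before  : List (Symbol extra)
    scanned : Symbol extra
    after   : List (Symbol extra)

module _ (M : TuringMachine) where
  open TuringMachine M

  private
    Tape : Set
    Tape = List (Symbol extra)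

  placeHead : Fin states → Tape → Tape → Configuration M
  placeHead q ls []       = config q ls blank []
  placeHead q ls (x ∷ rs) = config q ls x rs

  perform : Fin states → Move → Tape → Symbol extra → Tape → Configuration M
  perform q left  []       x rs = config q [] blank (x ∷ rs)
  perform q left  (l ∷ ls) x rs = config q ls l (x ∷ rs)
  perform q stay  ls       x rs = config q ls x rs
  perform q right ls       x rs = placeHead q (x ∷ ls) rs

  step : Configuration M → Maybe (Configuration M)
  step (config q ls x rs) = Maybe.map (λ { (q′ , y , d) → perform q′ d ls y rs }) (δ q x)

  -- The halting configuration, if it is reached within t steps.
  run : ℕ → Configuration M → Maybe (Configuration M)
  run t c with step c
  run t       c | nothing = just c
  run zero    c | just _  = nothing
  run (suc t) c | just c′ = run t c′

  initial : Word → Configuration M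
  initial w = placeHead start [] (List.map bit w)

  readBits : Tape → Word
  readBits (bit a ∷ xs) = a ∷ readBits xs
  readBits _            = []

  -- The output is the maximal bit string starting at the head.
  output : Configuration M → Word
  output (config _ _ x rs) = readBits (x ∷ rs)

  OutputsWithin : ℕ → Word → Word → Set
  OutputsWithin t v w = Maybe.map output (run t (initial v)) ≡ just w

-- For each a, the word 'out a' is computed from the word 'inp a'.
PolynomialTime : {A : Set} (inp out : A → Word) → Set
PolynomialTime inp out =
  ∃[ M ] ∃[ c ] ∃[ d ] ∀ a → OutputsWithin M (c * length (inp a) ^ d + c) (inp a) (out a)

------------------------------------------------------------------------
-- Encodings

unary : ℕ → Word
unary n = List.replicate n true ++ false ∷ []

-- Bijective base 2, least significant digit first.
binaryᵇ : ℕᵇ → Word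
binaryᵇ ℕᵇ.zero  = []
binaryᵇ 2[1+ n ] = true ∷ binaryᵇ n
binaryᵇ 1+[2 n ] = false ∷ binaryᵇ n

binary : ℕ → Word
binary n = binaryᵇ (ℕᵇ.fromℕ n)

encodeℤ : ℤ → Word
encodeℤ (ℤ.+ n)  = false ∷ binary n
encodeℤ -[1+ n ] = true ∷ binary (suc n)

encodeGraph : ∀ {n} → Graph n → Word
encodeGraph {n} G = unary n ++ concatMap (λ u → List.map (adj G u) (allFin n)) (allFin n)

encodeBoundariedGraph : ∀ {b} → BoundariedGraph b → Word
encodeBoundariedGraph {b} G = unary b ++ encodeGraph (graph G)

encodeSubset : ∀ {n} → Subset n → Word
encodeSubset = Vec.toList

Computable : (ℕ → ℕ) → Set
Computable f = ∃[ M ] ∀ n → ∃[ t ] OutputsWithin M t (binary n) (binary (f n))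

------------------------------------------------------------------------
-- Boundaried kernelization

record GraphMinimizationProblem : Set₁ where
  field
    Solution : ∀ {n} → Graph n → Set   -- feasible solutions
    value    : ∀ {n} (G : Graph n) → Solution G → ℕ
    encode   : ∀ {n} (G : Graph n) → Solution G → Word

vertexCover : GraphMinimizationProblem
vertexCover = record
  { Solution = λ {n} G → Σ (Subset n) (EdgelessWithout G)
  ; value    = λ G s → ∣ proj₁ s ∣
  ; encode   = λ G s → encodeSubset (proj₁ s)
  }

module _ (OPT : Optimum) (ρ : GraphMinimizationProblem) where
  open GraphMinimizationProblem ρ

  record Input : Set where
    field
      {b} : ℕ
      G   : BoundariedGraph b
      s   : Solution (graph G)

  record Output (b : ℕ) : Set where
    field
      G′ : BoundariedGraph b
      s′ : Solution (graph G′)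
      Δ  : ℤ

  encodeInput : Input → Word
  encodeInput i = encodeBoundariedGraph G ++ encode (graph G) s
    where open Input i

  encodeOutput : ∀ {b} → Output b → Word
  encodeOutput o = encodeBoundariedGraph G′ ++ encode (graph G′) s′ ++ encodeℤ Δ
    where open Output o

  record BoundariedKernelization (f : ℕ → ℕ) : Set where
    open Input
    open Output
    field
      kernel         : (i : Input) → Output (b i)
      polynomialTime : PolynomialTime encodeInput (λ i → encodeOutput (kernel i))
      equivalent     : ∀ i → GluingEquivalentBy OPT (G i) (G′ (kernel i)) (Δ (kernel i))

    bound : Input → ℕ
    bound i = f (b i + value (graph (G i)) (s i))

    field
      graph-size    : ∀ i → length (encodeGraph (graph (G′ (kernel i)))) ≤ bound i
      solution-size : ∀ i → length (encode (graph (G′ (kernel i))) (s′ (kernel i))) ≤ bound i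
      value-bound   : ∀ i → value (graph (G′ (kernel i))) (s′ (kernel i)) ≤ bound i

  -- Π[ρ] admits a boundaried kernelization, of some computable size.
  AdmitsBoundariedKernelization : Set
  AdmitsBoundariedKernelization = ∃[ f ] Computable f × BoundariedKernelization f

{-# OPTIONS --safe #-}
-- Let star n be n common neighbours of x and y, and path n be n internally
-- disjoint paths of length 3 from x to y.  In a maximum cut, star n is worth
-- 2n or n and path n is worth 2n or 3n, according to whether x and y are on
-- the same side or not.  Gluing path n to star n hence raises the maximum
-- cut by at most 2n.  Gluing path n to any other G puts all 3n extra edges
-- in the cut once x and y are separated, which raises the maximum cut by at
-- least 3n − (e − t), where e is the maximum cut of G and t its maximum cut
-- separating x and y.  Equivalent graphs gain equally, so star n ≡ G forces
-- n + t ≤ e.  For G = star m this says n ≤ m, and for general G it bounds n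
-- by the size of G, while star n has the vertex cover {x , y} for every n.
module Submission where

open import Defs
open import Data.Bool.Base using (Bool; true; false; _∧_; _∨_; not; if_then_else_)
open import Data.Bool.Properties using (_≟_; ∧-zeroʳ)
open import Data.Fin.Base using (Fin; zero; suc; splitAt; _↑ˡ_; _↑ʳ_)
open import Data.Fin.Properties using (all?; splitAt-↑ˡ; splitAt-↑ʳ; splitAt⁻¹-↑ʳ)
open import Data.Fin.Subset using (Subset; inside; outside; ⊥; _∉_; ∣_∣)
open import Data.Fin.Subset.Properties using (∣⊥∣≡0)
import Data.Integer.Base as ℤ
import Data.Integer.Properties as ℤₚ
open import Data.Integer.Solver using (module +-*-Solver)
open import Data.List.Base as List using (List; length; concatMap; allFin)
import Data.List.Properties as Listₚ
open import Data.Maybe.Base using (Maybe; just; nothing)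
open import Data.Maybe.Relation.Unary.All using (All; just; nothing)
open import Data.Nat.Base using (ℕ; zero; suc; _+_; _*_; _⊔_; _≤_; z≤n; s≤s)
open import Data.Nat.Properties hiding (_≟_)
open import Data.Nat.Solver using () renaming (module +-*-Solver to ℕSolver)
open import Data.Product.Base using (∃-syntax; _×_; _,_)
open import Data.Sum.Base using (inj₁; inj₂)
open import Data.Vec.Base as Vec using (Vec; []; _∷_; _++_; lookup)
open import Data.Vec.Properties using (lookup-splitAt; lookup-++ˡ; lookup-++ʳ; lookup⇒[]=; lookup-replicate)
open import Function.Base using (_∘_)
open import Relation.Binary.Bundles using (Setoid)
open import Relation.Binary.PropositionalEquality
open import Relation.Nullary.Decidable using (from-yes)
open import Relation.Nullary.Negation using (¬_; contradiction)

open import Algebra.Properties.CommutativeMonoid.Sum +-0-commutativeMonoid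
  using (sum; sum-cong-≗; sum-replicate-zero; ∑-distrib-+)

-- Sums

sum-splitAt : ∀ b {n} (f : Fin (b + n) → ℕ) →
  sum f ≡ sum (λ x → f (x ↑ˡ n)) + sum (λ i → f (b ↑ʳ i))
sum-splitAt zero    f = refl
sum-splitAt (suc b) f =
  trans (cong (f zero +_) (sum-splitAt b (f ∘ suc))) (sym (+-assoc (f zero) _ _))

sum-zero : ∀ {n} {f : Fin n → ℕ} → (∀ i → f i ≡ 0) → sum f ≡ 0
sum-zero {n} f≡0 = trans (sum-cong-≗ f≡0) (sum-replicate-zero n)

sum-≤ : ∀ {n c} {f : Fin n → ℕ} → (∀ i → f i ≤ c) → sum f ≤ n * c
sum-≤ {zero}  f≤c = z≤n
sum-≤ {suc n} f≤c = +-mono-≤ (f≤c zero) (sum-≤ (f≤c ∘ suc))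

module _ (b n m : ℕ) where

  sum-parts : (f : Fin (b + (n + m)) → ℕ) {fB : Fin b → ℕ} {fL : Fin n → ℕ} {fR : Fin m → ℕ} →
    (∀ x → f (x ↑ˡ (n + m)) ≡ fB x) →
    (∀ i → f (b ↑ʳ (i ↑ˡ m)) ≡ fL i) →
    (∀ j → f (b ↑ʳ (n ↑ʳ j)) ≡ fR j) →
    sum f ≡ sum fB + (sum fL + sum fR)
  sum-parts f eqB eqL eqR = trans (sum-splitAt b {n + m} f) (cong₂ _+_ (sum-cong-≗ {b} eqB)
    (trans (sum-splitAt n {m} (λ w → f (b ↑ʳ w))) (cong₂ _+_ (sum-cong-≗ {n} eqL) (sum-cong-≗ {m} eqR))))

  -- Vertices outside the left graph are sent to `nothing`, where `h` vanishes; the others meet each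
  -- left vertex exactly once.
  sum-toLeft : (h : Maybe (Fin (b + n)) → ℕ) → h nothing ≡ 0 →
    sum (h ∘ toLeft b n m) ≡ sum (h ∘ just)
  sum-toLeft h h≡0 = begin
    sum f                   ≡⟨ sum-parts f onB onL onR ⟩
    sum hB + (sum hL + sum {m} (λ _ → 0))  ≡⟨ cong (λ z → sum hB + (sum hL + z)) (sum-replicate-zero m) ⟩
    sum hB + (sum hL + 0)   ≡⟨ cong (sum hB +_) (+-identityʳ (sum hL)) ⟩
    sum hB + sum hL         ≡⟨ sum-splitAt b (h ∘ just) ⟨
    sum (h ∘ just)          ∎
    where
    open ≡-Reasoning
    f : Fin (b + (n + m)) → ℕ
    f = h ∘ toLeft b n m
    hB : Fin b → ℕ
    hB x = h (just (x ↑ˡ n))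
    hL : Fin n → ℕ
    hL i = h (just (b ↑ʳ i))
    onB : ∀ x → f (x ↑ˡ (n + m)) ≡ hB x
    onB x rewrite splitAt-↑ˡ b x (n + m) = refl
    onL : ∀ i → f (b ↑ʳ (i ↑ˡ m)) ≡ hL i
    onL i rewrite splitAt-↑ʳ b (n + m) (i ↑ˡ m) | splitAt-↑ˡ n i m = refl
    onR : ∀ j → f (b ↑ʳ (n ↑ʳ j)) ≡ 0
    onR j rewrite splitAt-↑ʳ b (n + m) (n ↑ʳ j) | splitAt-↑ʳ n m j = h≡0

  sum-toRight : (h : Maybe (Fin (b + m)) → ℕ) → h nothing ≡ 0 →
    sum (h ∘ toRight b n m) ≡ sum (h ∘ just)
  sum-toRight h h≡0 = begin
    sum f                   ≡⟨ sum-parts f onB onL onR ⟩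
    sum hB + (sum {n} (λ _ → 0) + sum hR)  ≡⟨ cong (λ z → sum hB + (z + sum hR)) (sum-replicate-zero n) ⟩
    sum hB + sum hR         ≡⟨ sum-splitAt b (h ∘ just) ⟨
    sum (h ∘ just)          ∎
    where
    open ≡-Reasoning
    f : Fin (b + (n + m)) → ℕ
    f = h ∘ toRight b n m
    hB : Fin b → ℕ
    hB x = h (just (x ↑ˡ m))
    hR : Fin m → ℕ
    hR j = h (just (b ↑ʳ j))
    onB : ∀ x → f (x ↑ˡ (n + m)) ≡ hB x
    onB x rewrite splitAt-↑ˡ b x (n + m) = refl
    onL : ∀ i → f (b ↑ʳ (i ↑ˡ m)) ≡ 0
    onL i rewrite splitAt-↑ʳ b (n + m) (i ↑ˡ m) | splitAt-↑ˡ n i m = h≡0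
    onR : ∀ j → f (b ↑ʳ (n ↑ʳ j)) ≡ hR j
    onR j rewrite splitAt-↑ʳ b (n + m) (n ↑ʳ j) | splitAt-↑ʳ n m j = refl

  module _ {A : Set} (xs : Vec A b) (ys : Vec A n) (zs : Vec A m) where

    -- A cut of a gluing restricts to a cut of the left graph with the same boundary part. `All` on
    -- `Maybe` makes this vacuous at vertices that the left graph lacks.
    lookup-toLeft : ∀ w → All (λ u → lookup (xs ++ (ys ++ zs)) w ≡ lookup (xs ++ ys) u) (toLeft b n m w)
    lookup-toLeft w rewrite lookup-splitAt b xs (ys ++ zs) w with splitAt b w
    ... | inj₁ x = just (sym (lookup-++ˡ xs ys x))
    ... | inj₂ v rewrite lookup-splitAt n ys zs v with splitAt n v
    ...   | inj₁ i = just (sym (lookup-++ʳ xs ys i))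
    ...   | inj₂ _ = nothing

    lookup-toRight : ∀ w → All (λ u → lookup (xs ++ (ys ++ zs)) w ≡ lookup (xs ++ zs) u) (toRight b n m w)
    lookup-toRight w rewrite lookup-splitAt b xs (ys ++ zs) w with splitAt b w
    ... | inj₁ x = just (sym (lookup-++ˡ xs zs x))
    ... | inj₂ v rewrite lookup-splitAt n ys zs v with splitAt n v
    ...   | inj₁ _ = nothing
    ...   | inj₂ j = just (sym (lookup-++ʳ xs zs j))

-- Maxima over subsets

maxOverSubsets-least : ∀ {n c} (f : Subset n → ℕ) → (∀ X → f X ≤ c) → maxOverSubsets f ≤ c
maxOverSubsets-least f f≤c with X , eq ← maxOverSubsets-attained f = subst (_≤ _) eq (f≤c X)

maxOverSubsets-cong : ∀ {n} {f g : Subset n → ℕ} → f ≗ g → maxOverSubsets f ≡ maxOverSubsets g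
maxOverSubsets-cong {zero}  f≗g = f≗g []
maxOverSubsets-cong {suc n} f≗g =
  cong₂ _⊔_ (maxOverSubsets-cong (f≗g ∘ (inside ∷_))) (maxOverSubsets-cong (f≗g ∘ (outside ∷_)))

maxOverSubsets-++ : ∀ n {m} (f : Subset (n + m) → ℕ) →
  maxOverSubsets f ≡ maxOverSubsets {n} (λ X → maxOverSubsets (λ Y → f (X ++ Y)))
maxOverSubsets-++ zero    f = refl
maxOverSubsets-++ (suc n) f =
  cong₂ _⊔_ (maxOverSubsets-++ n (f ∘ (inside ∷_))) (maxOverSubsets-++ n (f ∘ (outside ∷_)))

-- The two choices are independent: a pair of maximisers attains the sum of the maxima.
maxOverSubsets-+ : ∀ {n m} (f : Subset n → ℕ) (g : Subset m → ℕ) →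
  maxOverSubsets (λ X → maxOverSubsets (λ Y → f X + g Y)) ≡ maxOverSubsets f + maxOverSubsets g
maxOverSubsets-+ f g
  with X , fX ← maxOverSubsets-attained f
  with Y , gY ← maxOverSubsets-attained g = ≤-antisym
  (maxOverSubsets-least _ λ X → maxOverSubsets-least _ λ Y →
    +-mono-≤ (maxOverSubsets-upper f X) (maxOverSubsets-upper g Y))
  (subst (_≤ maxOverSubsets (λ X → maxOverSubsets (λ Y → f X + g Y))) (cong₂ _+_ fX gY)
    (≤-trans (maxOverSubsets-upper (λ Y → f X + g Y) Y)
             (maxOverSubsets-upper (λ X → maxOverSubsets (λ Y → f X + g Y)) X)))

-- Cuts of a gluing

-- Definitionally the summand of `cutSize`, with lookups and adjacency abstracted so that cases can
-- be split on Booleans.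
cutTerm : Bool → Bool → Bool → ℕ
cutTerm p q a = if p ∧ not q ∧ a then 1 else 0

cutTerm≤1 : ∀ p q a → cutTerm p q a ≤ 1
cutTerm≤1 p q a with p ∧ not q ∧ a
... | true  = s≤s z≤n
... | false = z≤n

-- A gluing keeps a common edge once, while the right-hand side would count it twice; hence the
-- disjointness hypothesis.
cutTerm-∨ : ∀ p q a c → a ∧ c ≡ false → cutTerm p q (a ∨ c) ≡ cutTerm p q a + cutTerm p q c
cutTerm-∨ true  true  _     _     _ = refl
cutTerm-∨ true  false true  false _ = refl
cutTerm-∨ true  false false _     _ = refl
cutTerm-∨ false _     _     _     _ = refl

cutTerm-false : ∀ p q → cutTerm p q false ≡ 0
cutTerm-false true  true  = refl
cutTerm-false true  false = refl
cutTerm-false false _     = refl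

-- Extension by zero to vertices outside the graph, the vanishing that `sum-toLeft` and
-- `sum-toRight` ask for.
cutTerm? : ∀ {n} → Graph n → Subset n → Maybe (Fin n) → Maybe (Fin n) → ℕ
cutTerm? G X (just u) (just v) = cutTerm (lookup X u) (lookup X v) (adj G u v)
cutTerm? G X (just _) nothing  = 0
cutTerm? G X nothing  _        = 0

cutTerm-adj? : ∀ {n} (G : Graph n) (X : Subset n) {p q u v} →
  All (λ i → p ≡ lookup X i) u → All (λ i → q ≡ lookup X i) v →
  cutTerm p q (adj? G u v) ≡ cutTerm? G X u v
cutTerm-adj? G X         (just refl) (just refl) = refl
cutTerm-adj? G X {p} {q} (just _)    nothing     = cutTerm-false p q
cutTerm-adj? G X {p} {q} nothing     _           = cutTerm-false p q

-- The hypothesis on ι holds for partial inverses of injections.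
cutSize-reindex : ∀ {n k} (G : Graph n) (X : Subset n) (ι : Fin k → Maybe (Fin n)) →
  (∀ h → h nothing ≡ 0 → sum (h ∘ ι) ≡ sum (h ∘ just)) →
  sum (λ u → sum (λ v → cutTerm? G X (ι u) (ι v))) ≡ cutSize G X
cutSize-reindex {n} {k} G X ι reindex = trans
  (sum-cong-≗ λ u → reindex (cutTerm? G X (ι u)) (nothingʳ (ι u)))
  (reindex (λ u → sum (λ v → cutTerm? G X u (just v))) (sum-zero {n} λ _ → refl))
  where
  nothingʳ : ∀ u → cutTerm? G X u nothing ≡ 0
  nothingʳ (just _) = refl
  nothingʳ nothing  = refl

BoundaryEdgeless : ∀ {b} → BoundariedGraph b → Set
BoundaryEdgeless {b} G = ∀ (x y : Fin b) → adj (graph G) (x ↑ˡ inner G) (y ↑ˡ inner G) ≡ false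

module _ {b : ℕ} (G H : BoundariedGraph b) (H-edgeless : BoundaryEdgeless H) where

  private
    n = inner G
    m = inner H
    l = toLeft b n m
    r = toRight b n m

  -- A common edge has both ends in both graphs, hence in the boundary, where `H` has no edge. In
  -- all other cases some end is sent to `nothing` by `l` or `r`, which makes that adjacency
  -- `false`.
  ⊕-edgeDisjoint : ∀ u v → adj? (graph G) (l u) (l v) ∧ adj? (graph H) (r u) (r v) ≡ false
  ⊕-edgeDisjoint u v with splitAt b u
  ⊕-edgeDisjoint u v | inj₂ w with splitAt n w
  ... | inj₁ _ = ∧-zeroʳ _
  ... | inj₂ _ = refl
  ⊕-edgeDisjoint u v | inj₁ x with splitAt b v
  ... | inj₁ y rewrite H-edgeless x y = ∧-zeroʳ _
  ... | inj₂ w with splitAt n w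
  ...   | inj₁ _ = ∧-zeroʳ _
  ...   | inj₂ _ = refl

  -- Every edge of the gluing comes from exactly one side, and both sides see the same boundary part
  -- `β`.
  cutSize-⊕ : ∀ (β : Subset b) (L : Subset n) (R : Subset m) →
    cutSize (G ⊕ H) (β ++ (L ++ R)) ≡ cutSize (graph G) (β ++ L) + cutSize (graph H) (β ++ R)
  cutSize-⊕ β L R = begin
    cutSize (G ⊕ H) (β ++ (L ++ R))
      ≡⟨ sum-cong-≗ (λ u → trans (sum-cong-≗ (term u)) (∑-distrib-+ (tG u) (tH u))) ⟩
    sum (λ u → sum (tG u) + sum (tH u))
      ≡⟨ ∑-distrib-+ (λ u → sum (tG u)) (λ u → sum (tH u)) ⟩
    sum (λ u → sum (tG u)) + sum (λ u → sum (tH u))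
      ≡⟨ cong₂ _+_ (cutSize-reindex (graph G) (β ++ L) l (sum-toLeft b n m))
                   (cutSize-reindex (graph H) (β ++ R) r (sum-toRight b n m)) ⟩
    cutSize (graph G) (β ++ L) + cutSize (graph H) (β ++ R) ∎
    where
    open ≡-Reasoning
    X : Subset (b + (n + m))
    X = β ++ (L ++ R)
    tG tH : Fin (b + (n + m)) → Fin (b + (n + m)) → ℕ
    tG u v = cutTerm? (graph G) (β ++ L) (l u) (l v)
    tH u v = cutTerm? (graph H) (β ++ R) (r u) (r v)
    term : ∀ u v → cutTerm (lookup X u) (lookup X v) (adj (G ⊕ H) u v) ≡ tG u v + tH u v
    term u v = trans
      (cutTerm-∨ (lookup X u) (lookup X v) _ _ (⊕-edgeDisjoint u v))
      (cong₂ _+_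
        (cutTerm-adj? (graph G) (β ++ L) (lookup-toLeft b n m β L R u) (lookup-toLeft b n m β L R v))
        (cutTerm-adj? (graph H) (β ++ R) (lookup-toRight b n m β L R u) (lookup-toRight b n m β L R v)))

-- Fixing the boundary part `β` of the cut makes the value additive under gluing (with no boundary
-- edges on the right), which the maximum cut itself is not in general.
maxCutWithTrace : ∀ {b} → BoundariedGraph b → Subset b → ℕ
maxCutWithTrace G β = maxOverSubsets (λ L → cutSize (graph G) (β ++ L))

glue : ∀ {b} → BoundariedGraph b → BoundariedGraph b → BoundariedGraph b
glue G H = record { inner = inner G + inner H ; graph = G ⊕ H }

-- With `β` fixed, the inner parts on the two sides are chosen independently, so the maxima add.
maxCutWithTrace-glue : ∀ {b} (G H : BoundariedGraph b) → BoundaryEdgeless H → ∀ β →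
  maxCutWithTrace (glue G H) β ≡ maxCutWithTrace G β + maxCutWithTrace H β
maxCutWithTrace-glue G H H-edgeless β = begin
  maxCutWithTrace (glue G H) β
    ≡⟨ maxOverSubsets-++ (inner G) _ ⟩
  maxOverSubsets {inner G} (λ L → maxOverSubsets {inner H} (λ R → cutSize (G ⊕ H) (β ++ (L ++ R))))
    ≡⟨ maxOverSubsets-cong (λ L → maxOverSubsets-cong (cutSize-⊕ G H H-edgeless β L)) ⟩
  maxOverSubsets {inner G} (λ L → maxOverSubsets {inner H} (λ R → cutSize (graph G) (β ++ L) + cutSize (graph H) (β ++ R)))
    ≡⟨ maxOverSubsets-+ {inner G} {inner H} _ _ ⟩
  maxCutWithTrace G β + maxCutWithTrace H β ∎
  where open ≡-Reasoning

maxCutℕ : ∀ {b} → BoundariedGraph b → ℕ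
maxCutℕ G = maxOverSubsets (cutSize (graph G))

-- Lower bounds on a maximum cut come from one well-chosen trace by this lemma, upper bounds from
-- all traces by `maxCutℕ-least`.
maxCutWithTrace≤maxCutℕ : ∀ {b} (G : BoundariedGraph b) β → maxCutWithTrace G β ≤ maxCutℕ G
maxCutWithTrace≤maxCutℕ {b} G β =
  ≤-trans (maxOverSubsets-upper (maxCutWithTrace G) β)
          (≤-reflexive (sym (maxOverSubsets-++ b (cutSize (graph G)))))

maxCutℕ-least : ∀ {b c} (G : BoundariedGraph b) → (∀ β → maxCutWithTrace G β ≤ c) → maxCutℕ G ≤ c
maxCutℕ-least {b} G ≤c =
  ≤-trans (≤-reflexive (maxOverSubsets-++ b (cutSize (graph G)))) (maxOverSubsets-least _ ≤c)

-- Copies of a gadget glued along the boundary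

copies : ∀ {b} → ℕ → BoundariedGraph b → BoundariedGraph b
copies zero    P = record { inner = 0 ; graph = record
  { adj = λ _ _ → false ; symmetric = λ _ _ → refl ; irreflexive = λ _ → refl } }
copies (suc k) P = glue (copies k P) P

copies-boundaryEdgeless : ∀ {b} k {P : BoundariedGraph b} → BoundaryEdgeless P → BoundaryEdgeless (copies k P)
copies-boundaryEdgeless         zero    P-edgeless x y = refl
copies-boundaryEdgeless {b} (suc k) {P} P-edgeless x y
  rewrite splitAt-↑ˡ b x (inner (copies k P) + inner P)
        | splitAt-↑ˡ b y (inner (copies k P) + inner P) =
  cong₂ _∨_ (copies-boundaryEdgeless k P-edgeless x y) (P-edgeless x y)

maxCutWithTrace-copies : ∀ {b} k (P : BoundariedGraph b) → BoundaryEdgeless P → ∀ β →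
  maxCutWithTrace (copies k P) β ≡ k * maxCutWithTrace P β
maxCutWithTrace-copies {b} zero P _ β =
  -- With no inner vertices only one cut has trace `β`, and with no edges its size is 0.
  sum-zero λ u → sum-zero λ v → cutTerm-false (lookup (β ++ []) u) (lookup (β ++ []) v)
maxCutWithTrace-copies (suc k) P P-edgeless β = begin
  maxCutWithTrace (glue (copies k P) P) β
    ≡⟨ maxCutWithTrace-glue (copies k P) P P-edgeless β ⟩
  maxCutWithTrace (copies k P) β + maxCutWithTrace P β
    ≡⟨ cong (_+ _) (maxCutWithTrace-copies k P P-edgeless β) ⟩
  k * maxCutWithTrace P β + maxCutWithTrace P β
    ≡⟨ +-comm (k * maxCutWithTrace P β) _ ⟩
  suc k * maxCutWithTrace P β ∎
  where open ≡-Reasoning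

-- `EdgelessWithout` the boundary, restated on inner indices so that it passes through the recursion
-- of `copies`.
InnerEdgeless : ∀ {b} → BoundariedGraph b → Set
InnerEdgeless {b} G = ∀ i j → adj (graph G) (b ↑ʳ i) (b ↑ʳ j) ≡ false

copies-innerEdgeless : ∀ {b} k {P : BoundariedGraph b} → InnerEdgeless P → InnerEdgeless (copies k P)
-- The case `zero` is absent because its inner indices would lie in `Fin 0`.
copies-innerEdgeless {b} (suc k) {P} P-edgeless i j
  rewrite splitAt-↑ʳ b (inner (copies k P) + inner P) i
        | splitAt-↑ʳ b (inner (copies k P) + inner P) j
  with splitAt (inner (copies k P)) i | splitAt (inner (copies k P)) j
... | inj₁ i′ | inj₁ j′ = cong (_∨ false) (copies-innerEdgeless k P-edgeless i′ j′)
... | inj₁ _  | inj₂ _  = refl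
... | inj₂ _  | inj₁ _  = refl
... | inj₂ i′ | inj₂ j′ = P-edgeless i′ j′

∉boundary⇒inner : ∀ {b} (G : BoundariedGraph b) u → u ∉ boundary G → ∃[ i ] u ≡ b ↑ʳ i
∉boundary⇒inner {b} G u u∉B with splitAt b u in eq
... | inj₂ i = i , sym (splitAt⁻¹-↑ʳ eq)
... | inj₁ x = contradiction (lookup⇒[]= u (boundary G) in-boundary) u∉B
  where
  in-boundary : lookup (boundary G) u ≡ inside
  in-boundary rewrite lookup-splitAt b (Vec.replicate b inside) (Vec.replicate (inner G) outside) u | eq =
    lookup-replicate x inside

edgelessWithoutBoundary : ∀ {b} (G : BoundariedGraph b) → InnerEdgeless G →
  EdgelessWithout (graph G) (boundary G)
edgelessWithoutBoundary G G-edgeless u v u∉B v∉B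
  with i , refl ← ∉boundary⇒inner G u u∉B | j , refl ← ∉boundary⇒inner G v v∉B = G-edgeless i j

-- The gadgets

star₁ : BoundariedGraph 2
star₁ = record { inner = 1 ; graph = record
  { adj         = edge
  ; symmetric   = from-yes (all? λ u → all? λ v → edge u v ≟ edge v u)
  ; irreflexive = from-yes (all? λ v → edge v v ≟ false)
  } }
  where
  edge : Fin 3 → Fin 3 → Bool
  edge u v = lookup (lookup
    ( (false ∷ false ∷ true  ∷ [])
    ∷ (false ∷ false ∷ true  ∷ [])
    ∷ (true  ∷ true  ∷ false ∷ []) ∷ []) u) v

-- The path 0 - 2 - 3 - 1.
path₁ : BoundariedGraph 2
path₁ = record { inner = 2 ; graph = record
  { adj         = edge
  ; symmetric   = from-yes (all? λ u → all? λ v → edge u v ≟ edge v u)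
  ; irreflexive = from-yes (all? λ v → edge v v ≟ false)
  } }
  where
  edge : Fin 4 → Fin 4 → Bool
  edge u v = lookup (lookup
    ( (false ∷ false ∷ true  ∷ false ∷ [])
    ∷ (false ∷ false ∷ false ∷ true  ∷ [])
    ∷ (true  ∷ false ∷ false ∷ true  ∷ [])
    ∷ (false ∷ true  ∷ true  ∷ false ∷ []) ∷ []) u) v

-- `star n` is the complete bipartite graph with the boundary as one side and `n` vertices on the
-- other.
star path : ℕ → BoundariedGraph 2
star n = copies n star₁
path n = copies n path₁

star₁-boundaryEdgeless : BoundaryEdgeless star₁
star₁-boundaryEdgeless = from-yes (all? {n = 2} λ x → all? {n = 2} λ y → adj (graph star₁) (x ↑ˡ 1) (y ↑ˡ 1) ≟ false)

path₁-boundaryEdgeless : BoundaryEdgeless path₁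
path₁-boundaryEdgeless = from-yes (all? {n = 2} λ x → all? {n = 2} λ y → adj (graph path₁) (x ↑ˡ 2) (y ↑ˡ 2) ≟ false)

star-edgelessWithoutBoundary : ∀ n → EdgelessWithout (graph (star n)) (boundary (star n))
star-edgelessWithoutBoundary n =
  edgelessWithoutBoundary (star n) (copies-innerEdgeless n λ { zero zero → refl })

-- Swapping the two sides of a cut preserves its size, so these represent all four traces.
together separated : Subset 2
together  = inside ∷ inside ∷ []
separated = inside ∷ outside ∷ []

-- Maximum cuts after gluing the gadgets

maxCutWithTrace-star : ∀ n β → maxCutWithTrace (star n) β ≡ n * maxCutWithTrace star₁ β
maxCutWithTrace-star n = maxCutWithTrace-copies n star₁ star₁-boundaryEdgeless

maxCutWithTrace-⊕-path : ∀ (G : BoundariedGraph 2) n β →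
  maxCutWithTrace (glue G (path n)) β ≡ maxCutWithTrace G β + n * maxCutWithTrace path₁ β
maxCutWithTrace-⊕-path G n β = trans
  (maxCutWithTrace-glue G (path n) (copies-boundaryEdgeless n path₁-boundaryEdgeless) β)
  (cong (maxCutWithTrace G β +_) (maxCutWithTrace-copies n path₁ path₁-boundaryEdgeless β))

-- The two gadgets have opposite preferences that cancel exactly: 2 + 2 with the boundary together,
-- 1 + 3 with it separated. Each `refl` evaluates the maxima over all inner parts.
star₁+path₁ : ∀ β → maxCutWithTrace star₁ β + maxCutWithTrace path₁ β ≡ 4
star₁+path₁ (true  ∷ true  ∷ []) = refl
star₁+path₁ (true  ∷ false ∷ []) = refl
star₁+path₁ (false ∷ true  ∷ []) = refl
star₁+path₁ (false ∷ false ∷ []) = refl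

star₁≤2 : ∀ β → maxCutWithTrace star₁ β ≤ 2
star₁≤2 (true  ∷ true  ∷ []) = ≤-refl
star₁≤2 (true  ∷ false ∷ []) = s≤s z≤n
star₁≤2 (false ∷ true  ∷ []) = s≤s z≤n
star₁≤2 (false ∷ false ∷ []) = ≤-refl

maxCut-star⊕path : ∀ n → maxCutℕ (glue (star n) (path n)) ≤ n * 4
maxCut-star⊕path n = maxCutℕ-least (glue (star n) (path n)) λ β → ≤-reflexive (begin
  maxCutWithTrace (glue (star n) (path n)) β
    ≡⟨ maxCutWithTrace-⊕-path (star n) n β ⟩
  maxCutWithTrace (star n) β + n * maxCutWithTrace path₁ β
    ≡⟨ cong (_+ n * maxCutWithTrace path₁ β) (maxCutWithTrace-star n β) ⟩
  n * maxCutWithTrace star₁ β + n * maxCutWithTrace path₁ β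
    ≡⟨ *-distribˡ-+ n (maxCutWithTrace star₁ β) _ ⟨
  n * (maxCutWithTrace star₁ β + maxCutWithTrace path₁ β)
    ≡⟨ cong (n *_) (star₁+path₁ β) ⟩
  n * 4 ∎)
  where open ≡-Reasoning

maxCut-star : ∀ n → maxCutℕ (star n) ≤ n * 2
maxCut-star n = maxCutℕ-least (star n) λ β →
  ≤-trans (≤-reflexive (maxCutWithTrace-star n β)) (*-monoʳ-≤ n (star₁≤2 β))

-- An equivalence speaks of gluings only, so the maximum cut of `star n` enters through the edgeless
-- `path 0`.
maxCut-star⊕path₀ : ∀ n → n * 2 ≤ maxCutℕ (glue (star n) (path 0))
maxCut-star⊕path₀ n = begin
  n * 2                                              ≡⟨ maxCutWithTrace-star n together ⟨
  maxCutWithTrace (star n) together                  ≡⟨ +-identityʳ _ ⟨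
  -- The summand `0` is the reduct of `0 * maxCutWithTrace path₁ together`.
  maxCutWithTrace (star n) together + 0              ≡⟨ maxCutWithTrace-⊕-path (star n) 0 together ⟨
  maxCutWithTrace (glue (star n) (path 0)) together  ≤⟨ maxCutWithTrace≤maxCutℕ (glue (star n) (path 0)) together ⟩
  maxCutℕ (glue (star n) (path 0))                   ∎
  where open ≤-Reasoning

-- `glue G (path 0)` has `inner G + 0` inner vertices, which is not `inner G` by definition, so the
-- comparison goes trace by trace.
maxCut-⊕path₀ : ∀ G → maxCutℕ (glue G (path 0)) ≤ maxCutℕ G
maxCut-⊕path₀ G = maxCutℕ-least (glue G (path 0)) λ β → begin
  maxCutWithTrace (glue G (path 0)) β  ≡⟨ maxCutWithTrace-⊕-path G 0 β ⟩
  maxCutWithTrace G β + 0              ≡⟨ +-identityʳ _ ⟩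
  maxCutWithTrace G β                  ≤⟨ maxCutWithTrace≤maxCutℕ G β ⟩
  maxCutℕ G                            ∎
  where open ≤-Reasoning

-- Separating the boundary vertices lets all three edges of every path be cut.
maxCut-⊕path : ∀ G n → maxCutWithTrace G separated + n * 3 ≤ maxCutℕ (glue G (path n))
maxCut-⊕path G n = ≤-trans
  (≤-reflexive (sym (maxCutWithTrace-⊕-path G n separated)))
  (maxCutWithTrace≤maxCutℕ (glue G (path n)) separated)

-- Applying an equivalence to two right-hand sides eliminates Δ.
gluing-difference : ∀ {b} (G G′ : BoundariedGraph b) → GluingEquivalent maxCut G G′ → ∀ H K →
  maxCutℕ (glue G H) + maxCutℕ (glue G′ K) ≡ maxCutℕ (glue G K) + maxCutℕ (glue G′ H)
gluing-difference G G′ (Δ , equiv) H K = ℤₚ.+-injective (begin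
  maxCut (G ⊕ H) ℤ.+ maxCut (G′ ⊕ K)            ≡⟨ cong (ℤ._+ maxCut (G′ ⊕ K)) (equiv H) ⟩
  (maxCut (G′ ⊕ H) ℤ.+ Δ) ℤ.+ maxCut (G′ ⊕ K)   ≡⟨ swap (maxCut (G′ ⊕ H)) Δ (maxCut (G′ ⊕ K)) ⟩
  (maxCut (G′ ⊕ K) ℤ.+ Δ) ℤ.+ maxCut (G′ ⊕ H)   ≡⟨ cong (ℤ._+ maxCut (G′ ⊕ H)) (equiv K) ⟨
  maxCut (G ⊕ K) ℤ.+ maxCut (G′ ⊕ H)            ∎)
  where
  open ≡-Reasoning
  open +-*-Solver
  swap : ∀ x y z → (x ℤ.+ y) ℤ.+ z ≡ (z ℤ.+ y) ℤ.+ x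
  swap = solve 3 (λ x y z → (x :+ y) :+ z := (z :+ y) :+ x) refl

-- Graphs equivalent to a star

star≡⇒≤ : ∀ n (G : BoundariedGraph 2) → GluingEquivalent maxCut (star n) G →
  n + maxCutWithTrace G separated ≤ maxCutℕ G
-- The cancelled `n * 4` is the bound on the maximum cut of `star n` glued to `path n`.
star≡⇒≤ n G equiv = +-cancelˡ-≤ (n * 4) _ _ (begin
  n * 4 + (n + t)                                                ≡⟨ rearrange n t ⟩
  n * 2 + (t + n * 3)                                            ≤⟨ +-mono-≤ (maxCut-star⊕path₀ n) (maxCut-⊕path G n) ⟩
  maxCutℕ (glue (star n) (path 0)) + maxCutℕ (glue G (path n))   ≡⟨ gluing-difference (star n) G equiv (path 0) (path n) ⟩
  maxCutℕ (glue (star n) (path n)) + maxCutℕ (glue G (path 0))   ≤⟨ +-mono-≤ (maxCut-star⊕path n) (maxCut-⊕path₀ G) ⟩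
  n * 4 + maxCutℕ G                                              ∎)
  where
  open ≤-Reasoning
  open ℕSolver
  t : ℕ
  t = maxCutWithTrace G separated
  rearrange : ∀ n t → n * 4 + (n + t) ≡ n * 2 + (t + n * 3)
  rearrange = solve 2 (λ n t → n :* con 4 :+ (n :+ t) := n :* con 2 :+ (t :+ n :* con 3)) refl

-- For `star m` the separated value is `m` and the maximum cut at most `2m`, a difference of at most
-- `m`.
star≡star⇒≤ : ∀ n m → GluingEquivalent maxCut (star n) (star m) → n ≤ m
star≡star⇒≤ n m equiv = +-cancelʳ-≤ m n m (begin
  n + m                                     ≡⟨ cong (n +_) (*-identityʳ m) ⟨
  n + m * 1                                 ≡⟨ cong (n +_) (maxCutWithTrace-star m separated) ⟨
  n + maxCutWithTrace (star m) separated    ≤⟨ star≡⇒≤ n (star m) equiv ⟩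
  maxCutℕ (star m)                          ≤⟨ maxCut-star m ⟩
  m * 2                                     ≡⟨ *-comm m 2 ⟩
  m + (m + 0)                               ≡⟨ cong (m +_) (+-identityʳ m) ⟩
  m + m                                     ∎)
  where open ≤-Reasoning

infinitelyManyClasses : InfinitelyManyClasses (edgelessGluingSetoid maxCut 2)
infinitelyManyClasses = record
  { to        = λ n → star n , star-edgelessWithoutBoundary n
  ; cong      = λ { {n} refl → ≈-refl n }
  ; injective = λ {n} {m} equiv → ≤-antisym (star≡star⇒≤ n m equiv) (star≡star⇒≤ m n (≈-sym {star n} {star m} equiv))
  }
  where
  ≈-sym : ∀ {G H : BoundariedGraph 2} → GluingEquivalent maxCut G H → GluingEquivalent maxCut H G
  ≈-sym {G} {H} = Setoid.sym (gluingSetoid maxCut 2) {G} {H}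
  ≈-refl : ∀ n → GluingEquivalent maxCut (star n) (star n)
  ≈-refl n = Setoid.refl (gluingSetoid maxCut 2) {star n}

-- Sizes of encodings

length-concatMap : ∀ {A B : Set} {c} (f : A → List B) xs →
  (∀ x → length (f x) ≡ c) → length (concatMap f xs) ≡ length xs * c
length-concatMap f List.[]       eq = refl
length-concatMap f (x List.∷ xs) eq =
  trans (Listₚ.length-++ (f x)) (cong₂ _+_ (eq x) (length-concatMap f xs eq))

-- The adjacency matrix alone takes one bit per ordered pair of vertices.
n*n≤length-encodeGraph : ∀ {n} (G : Graph n) → n * n ≤ length (encodeGraph G)
n*n≤length-encodeGraph {n} G = begin
  n * n                                ≡⟨ cong (_* n) length-allFin ⟨
  length (allFin n) * n                ≡⟨ length-concatMap row (allFin n) length-row ⟨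
  length (concatMap row (allFin n))    ≤⟨ Listₚ.length-++-≤ʳ (concatMap row (allFin n)) {unary n} ⟩
  length (encodeGraph G)               ∎
  where
  open ≤-Reasoning
  row : Fin n → Word
  row u = List.map (adj G u) (allFin n)
  length-allFin : length (allFin n) ≡ n
  length-allFin = Listₚ.length-tabulate {n = n} (λ i → i)
  length-row : ∀ u → length (row u) ≡ n
  length-row u = trans (Listₚ.length-map (adj G u) (allFin n)) length-allFin

-- Each ordered pair contributes at most 1 to a cut, so the size bound of a kernel also bounds its
-- maximum cut.
maxCutℕ≤length-encodeGraph : ∀ {b} (G : BoundariedGraph b) → maxCutℕ G ≤ length (encodeGraph (graph G))
maxCutℕ≤length-encodeGraph {b} G = maxOverSubsets-least _ λ X → begin
  cutSize (graph G) X               ≤⟨ sum-≤ (λ u → sum-≤ (term≤1 X u)) ⟩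
  N * (N * 1)                       ≡⟨ cong (N *_) (*-identityʳ N) ⟩
  N * N                             ≤⟨ n*n≤length-encodeGraph (graph G) ⟩
  length (encodeGraph (graph G))    ∎
  where
  open ≤-Reasoning
  N : ℕ
  N = b + inner G
  term≤1 : ∀ X u v → cutTerm (lookup X u) (lookup X v) (adj (graph G) u v) ≤ 1
  term≤1 X u v = cutTerm≤1 (lookup X u) (lookup X v) (adj (graph G) u v)

-- Impossibility of a kernelization

noKernelization : ∀ f → ¬ BoundariedKernelization maxCut vertexCover f
noKernelization f K = n≮n (f 4) (begin
  suc (f 4)                                 ≤⟨ m≤m+n (suc (f 4)) _ ⟩
  suc (f 4) + maxCutWithTrace G′ separated  ≤⟨ star≡⇒≤ (suc (f 4)) G′ (Output.Δ (kernel i) , equivalent i) ⟩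
  maxCutℕ G′                                ≤⟨ maxCutℕ≤length-encodeGraph G′ ⟩
  length (encodeGraph (graph G′))           ≤⟨ graph-size i ⟩
  -- `boundary G` computes to two `inside` entries followed by `⊥`.
  f (2 + (2 + ∣ ⊥ {inner G} ∣))             ≡⟨ cong (λ k → f (4 + k)) (∣⊥∣≡0 (inner G)) ⟩
  f 4                                       ∎)
  where
  open ≤-Reasoning
  open BoundariedKernelization K
  G : BoundariedGraph 2
  -- Boundary size plus cover size is 2 + 2 = 4 for every star, so the star can be taken one larger
  -- than the resulting bound `f 4`.
  G = star (suc (f 4))
  i : Input maxCut vertexCover
  i = record { G = G ; s = boundary G , star-edgelessWithoutBoundary (suc (f 4)) }
  G′ : BoundariedGraph 2
  G′ = Output.G′ (kernel i)

mainTheorem11 : InfinitelyManyClasses (edgelessGluingSetoid maxCut 2)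
    × ¬ AdmitsBoundariedKernelization maxCut vertexCover
mainTheorem11 = infinitelyManyClasses , λ { (f , _ , K) → noKernelization f K }
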